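{- Let $G$ be a graph on $n$ vertices with no isolated vertices that satisfies both of the following conditions: (a) for every edge $uv$ of $G$, $d_G(u)+d_G(v)\ge 4$; (b) no two vertices of degree $1$ in $G$ are at distance exactly $4$ in $G$. Then $\gamma_{\rm tg}(G)\le \frac{3}{4}n$.
   Context: For a graph $G$ without isolated vertices, a vertex $x$ totally dominates a vertex $y$ if $x$ and $y$ are adjacent. The total domination game on $G$ is played by two players, Dominator and Staller, who alternately choose vertices of $G$, Dominator choosing first. A vertex may be chosen only if it totally dominates at least one vertex that is not totally dominated by the previously chosen vertices. The game ends when the set of chosen vertices is a total dominating set of $G$, i.e. every vertex of $G$ has a neighbor among the chosen vertices. Dominator wants to minimize the number of chosen vertices and Staller wants to maximize it. The game total domination number $\gamma_{\rm tg}(G)$ is the number of vertices chosen when Dominator starts and both players play optimally. A leaf is a vertex of degree $1$. -}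

module Defs where

open import Data.Fin.Base using (Fin)
open import Data.Fin.Properties using (all?; any?; ¬∀⟶∃¬)
open import Data.Fin.Subset using (Subset; _∈_; _∪_; _⊃_; ⁅_⁆; ⊥)
open import Data.Fin.Subset.Induction using (Acc; acc; ⊃-wellFounded)
open import Data.Fin.Subset.Properties using (_∈?_; p⊆p∪q; q⊆p∪q; x∈⁅x⁆)
open import Data.List.Base using (List; map; mapMaybe; allFin)
open import Data.List.Extrema.Nat using (min; max)
import Data.Maybe.Base as Maybe
open import Data.Nat.Base using (ℕ; zero; suc; _≤_)
open import Data.Product.Base using (∃; _×_; _,_)
import Data.Vec.Base as Vec
open import Level using (0ℓ)
open import Relation.Binary.Core using (Rel)
open import Relation.Binary.Definitions using (Decidable; Symmetric; Irreflexive)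
open import Relation.Binary.PropositionalEquality.Core using (_≡_)
open import Relation.Nullary.Decidable using (yes; no; dec⇒maybe; _×-dec_; ¬?)
open import Relation.Nullary.Negation using (¬_)
import Relation.Unary as Unary

record Graph (n : ℕ) : Set₁ where
  infix 4 _~_ _~?_
  field
    _~_      : Rel (Fin n) 0ℓ
    _~?_     : Decidable _~_
    ~-sym    : Symmetric _~_
    ~-irrefl : Irreflexive _≡_ _~_

  degree : Fin n → ℕ
  degree v = Vec.count (v ~?_) (Vec.allFin n)

  Leaf : Fin n → Set
  Leaf v = degree v ≡ 1

  NoIsolatedVertices : Set
  NoIsolatedVertices = ∀ v → ∃ λ u → v ~ u

  data Walk : Fin n → Fin n → ℕ → Set where
    []  : ∀ {u} → Walk u u zero
    _∷_ : ∀ {u v w k} → u ~ v → Walk v w k → Walk u w (suc k)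

  -- Vertices in different components are at no distance d.
  Distance : Fin n → Fin n → ℕ → Set
  Distance u v d = Walk u v d × (∀ {k} → Walk u v k → d ≤ k)

  TotallyDominates : Fin n → Fin n → Set
  TotallyDominates x y = x ~ y

  TotallyDominated : Subset n → Fin n → Set
  TotallyDominated S y = ∃ λ x → x ∈ S × TotallyDominates x y

  totallyDominated? : ∀ S → Unary.Decidable (TotallyDominated S)
  totallyDominated? S y = any? λ x → x ∈? S ×-dec x ~? y

  TotalDominatingSet : Subset n → Set
  TotalDominatingSet S = ∀ y → TotallyDominated S y

  totalDominatingSet? : Unary.Decidable TotalDominatingSet
  totalDominatingSet? S = all? (totallyDominated? S)

  Legal : Subset n → Fin n → Set
  Legal S v = ∃ λ y → TotallyDominates v y × ¬ TotallyDominated S y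

  legal? : ∀ S → Unary.Decidable (Legal S)
  legal? S v = any? λ y → v ~? y ×-dec ¬? (totallyDominated? S y)

  legalMoves : ∀ S → List (∃ (Legal S))
  legalMoves S =
    mapMaybe (λ v → Maybe.map (v ,_) (dec⇒maybe (legal? S v))) (allFin n)

  legal⇒⊃ : ∀ {S v} → Legal S v → (S ∪ ⁅ v ⁆) ⊃ S
  legal⇒⊃ {S} {v} (y , v~y , ¬dom) =
    p⊆p∪q ⁅ v ⁆ ,
    v , q⊆p∪q S ⁅ v ⁆ (x∈⁅x⁆ v) , λ v∈S → ¬dom (v , v∈S , v~y)

data Player : Set where
  dominator staller : Player

opponent : Player → Player
opponent dominator = staller
opponent staller   = dominator

-- The first number is itself one of the candidates; it keeps the choice nonempty.
best : Player → ℕ → List ℕ → ℕ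
best dominator = min
best staller   = max

module TotalDominationGame {n} (G : Graph n)
  (noIsolated : Graph.NoIsolatedVertices G) where

  open Graph G

  someLegalMove : ∀ S → ¬ TotalDominatingSet S → ∃ (Legal S)
  someLegalMove S ¬tds =
    let y , ¬dom = ¬∀⟶∃¬ n (TotallyDominated S) (totallyDominated? S) ¬tds
        v , y~v  = noIsolated y
    in  v , y , ~-sym y~v , ¬dom

  -- The number of vertices still to be chosen, under optimal play, when S is
  -- the set of vertices chosen so far and p is to move.
  value : Player → (S : Subset n) → Acc _⊃_ S → ℕ
  value p S (acc larger) with totalDominatingSet? S
  ... | yes _   = 0
  ... | no ¬tds = suc (best p (after (someLegalMove S ¬tds)) (map after (legalMoves S)))
    where
    after : ∃ (Legal S) → ℕ
    after (v , legal) = value (opponent p) (S ∪ ⁅ v ⁆) (larger (legal⇒⊃ legal))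

  γtg : ℕ
  γtg = value dominator ⊥ (⊃-wellFounded ⊥)

open TotalDominationGame public using (γtg)

{-# OPTIONS --safe #-}
module Submission where

-- Dominator plays against the potential
--   weight = 2 #undominated vertices + #legal moves + #endangered leaves,
-- which starts at 3n. A leaf is endangered when it is undominated and its support
-- vertex (its only neighbour) is dominated or has at most two undominated
-- neighbours. Dominator plays the support of an undominated leaf if that dominates
-- at least two vertices, otherwise any move dominating at least two; either lowers
-- the weight by at least 5. Once every move dominates one vertex only, every move
-- lowers the weight by at least 4. A move of Staller lowers the weight by at least
-- 3, or else leaves a support whose play brings the loss of the two moves to at
-- least 8. By condition (b), two supports with a common neighbour are adjacent, so
-- any one newly dominated vertex endangers at most two leaves that remain legal.

open import Defs
open import Data.Fin.Base using (Fin; zero; suc)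
open import Data.Fin.Properties using (_≟_; any?)
open import Data.Fin.Subset using (Subset; _∪_; _⊃_; ⁅_⁆; ⊥)
open import Data.Fin.Subset.Induction using (acc; ⊃-wellFounded)
open import Data.Fin.Subset.Properties using (x∈p∪q⁺; x∈p∪q⁻; x∈⁅x⁆; x∈⁅y⁆⇒x≡y; ∉⊥; ⊂-trans)
open import Data.List.Base using (List; []; _∷_; length; allFin)
open import Data.List.Extrema.Nat using (min≤v⁺; argmax-all; argmin-all)
open import Data.List.Membership.Propositional using (find; lose)
open import Data.List.Membership.Propositional.Properties using (∈-map⁺; ∈-allFin)
open import Data.List.Relation.Unary.All as All using (All; []; _∷_)
import Data.List.Relation.Unary.All.Properties as All
open import Data.List.Relation.Unary.AllPairs using ([]; _∷_)
import Data.List.Relation.Unary.Any as Any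
import Data.List.Relation.Unary.Any.Properties as Any
open import Data.List.Relation.Unary.Unique.Propositional using (Unique)
import Data.Maybe.Base as Maybe
import Data.Maybe.Relation.Unary.Any as MaybeAny
open import Data.Nat.Base using (ℕ; zero; suc; _+_; _*_; _≤_; _<_; z≤n; s≤s; s≤s⁻¹)
import Data.Nat.Base as ℕ
open import Data.Nat.Properties
  using ( +-0-commutativeMonoid; +-mono-≤; +-monoˡ-≤; +-monoʳ-≤; *-monoʳ-≤; *-identityʳ
        ; ≤-refl; ≤-reflexive; ≤-trans; m≤m+n; m≤n+m; module ≤-Reasoning)
import Data.Nat.Properties as ℕ
open import Data.Nat.Tactic.RingSolver using (solve-∀)
open import Data.Product.Base using (∃; _×_; _,_; proj₁; proj₂)
open import Data.Sum.Base using (_⊎_; inj₁; inj₂; [_,_]′)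
import Data.Vec.Base as Vec
open import Data.Vec.Functional using (Vector)
open import Function.Base using (_∘_; id; flip)
open import Induction.WellFounded using (module All)
open import Level using (0ℓ)
open import Relation.Binary.PropositionalEquality
  using (_≡_; _≢_; refl; sym; trans; cong; subst; ≢-sym)
open import Relation.Nullary.Decidable
  using (Dec; yes; no; dec⇒maybe; _×-dec_; _⊎-dec_; _→-dec_; ¬?; decidable-stable)
open import Relation.Nullary.Negation using (¬_; contradiction)
open import Relation.Unary using (Pred; Decidable)
open import Algebra.Properties.CommutativeMonoid.Sum +-0-commutativeMonoid
  using (sum; sum-cong-≗; ∑-distrib-+; ∑-comm)

-- Counting by sums of indicators.

𝟙 : {A : Set} → Dec A → ℕ
𝟙 (yes _) = 1
𝟙 (no _)  = 0

𝟙≤1 : {A : Set} (A? : Dec A) → 𝟙 A? ≤ 1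
𝟙≤1 (yes _) = ≤-refl
𝟙≤1 (no _)  = z≤n

𝟙≤ : {A : Set} (A? : Dec A) {m : ℕ} → (A → 1 ≤ m) → 𝟙 A? ≤ m
𝟙≤ (yes a) f = f a
𝟙≤ (no _)  f = z≤n

𝟙-true : {A : Set} (A? : Dec A) → A → 1 ≤ 𝟙 A?
𝟙-true (yes _) _ = ≤-refl
𝟙-true (no ¬a) a = contradiction a ¬a

𝟙-mono : {A B : Set} (A? : Dec A) (B? : Dec B) → (A → B) → 𝟙 A? ≤ 𝟙 B?
𝟙-mono A? B? f = 𝟙≤ A? (𝟙-true B? ∘ f)

sum-mono : ∀ {n} {f g : Vector ℕ n} → (∀ i → f i ≤ g i) → sum f ≤ sum g
sum-mono {zero}  f≤g = z≤n
sum-mono {suc n} f≤g = +-mono-≤ (f≤g zero) (sum-mono (f≤g ∘ suc))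

f[i]≤sum : ∀ {n} (f : Vector ℕ n) i → f i ≤ sum f
f[i]≤sum {suc n} f zero    = m≤m+n (f zero) _
f[i]≤sum {suc n} f (suc i) = ≤-trans (f[i]≤sum (f ∘ suc) i) (m≤n+m _ (f zero))

*-sum : ∀ {n} m (f : Vector ℕ n) → sum (λ i → m * f i) ≡ m * sum f
*-sum zero    f = sum-zero f
  where
  sum-zero : ∀ {n} (f : Vector ℕ n) → sum (λ i → 0 * f i) ≡ 0
  sum-zero {zero}  f = refl
  sum-zero {suc n} f = sum-zero (f ∘ suc)
*-sum (suc m) f = trans (∑-distrib-+ f (λ i → m * f i)) (cong (sum f +_) (*-sum m f))

module _ {n : ℕ} where

  private variable
    P Q R : Pred (Fin n) 0ℓ

  count : Decidable P → ℕ
  count P? = sum (λ i → 𝟙 (P? i))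

  count-mono : (P? : Decidable P) (Q? : Decidable Q) → (∀ {i} → P i → Q i) → count P? ≤ count Q?
  count-mono P? Q? P⊆Q = sum-mono (λ i → 𝟙-mono (P? i) (Q? i) P⊆Q)

  count-⊎ : (P? : Decidable P) (Q? : Decidable Q) (R? : Decidable R) →
            (∀ {i} → P i → Q i ⊎ R i) → count P? ≤ count Q? + count R?
  count-⊎ P? Q? R? split = ≤-trans (sum-mono point) (≤-reflexive (∑-distrib-+ (𝟙 ∘ Q?) (𝟙 ∘ R?)))
    where
    point : ∀ i → 𝟙 (P? i) ≤ 𝟙 (Q? i) + 𝟙 (R? i)
    point i = 𝟙≤ (P? i) λ p →
      [ (λ q → ≤-trans (𝟙-true (Q? i) q) (m≤m+n _ _))
      , (λ r → ≤-trans (𝟙-true (R? i) r) (m≤n+m _ _)) ]′ (split p)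

  count-disjoint : (P? : Decidable P) (Q? : Decidable Q) (R? : Decidable R) →
                   (∀ {i} → P i → R i) → (∀ {i} → Q i → R i) → (∀ {i} → P i → ¬ Q i) →
                   count P? + count Q? ≤ count R?
  count-disjoint P? Q? R? P⊆R Q⊆R ¬PQ =
    ≤-trans (≤-reflexive (sym (∑-distrib-+ (𝟙 ∘ P?) (𝟙 ∘ Q?)))) (sum-mono point)
    where
    point : ∀ i → 𝟙 (P? i) + 𝟙 (Q? i) ≤ 𝟙 (R? i)
    point i with P? i | Q? i
    ... | yes p | yes q = contradiction q (¬PQ p)
    ... | yes p | no _  = 𝟙-true (R? i) (P⊆R p)
    ... | no _  | Q?i   = 𝟙-mono Q?i (R? i) Q⊆R

  count-empty : (P? : Decidable P) → (∀ {i} → ¬ P i) → count P? ≡ 0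
  count-empty P? ¬P = trans (sum-cong-≗ point) (*-sum 0 (λ (_ : Fin n) → 0))
    where
    point : ∀ i → 𝟙 (P? i) ≡ 0
    point i with P? i
    ... | yes p = contradiction p ¬P
    ... | no _  = refl

  _∖_ : Decidable P → ∀ i → Decidable (λ j → P j × i ≢ j)
  (P? ∖ i) j = P? j ×-dec ¬? (i ≟ j)

count-≟ : ∀ {n} (i : Fin n) → count (i ≟_) ≤ 1
count-≟ {suc n} zero    = s≤s (≤-reflexive (count-empty {n} (λ j → zero ≟ suc j) λ ()))
count-≟ {suc n} (suc i) =
  ≤-trans (count-mono (λ j → suc i ≟ suc j) (i ≟_) λ { refl → refl }) (count-≟ i)

count≤n : ∀ {n} {P : Pred (Fin n) 0ℓ} (P? : Decidable P) → count P? ≤ n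
count≤n {zero}  P? = z≤n
count≤n {suc n} P? = +-mono-≤ (𝟙≤1 (P? zero)) (count≤n (P? ∘ suc))

module _ {n : ℕ} where

  count-intro : {P : Pred (Fin n) 0ℓ} (P? : Decidable P) {xs : List (Fin n)} →
                Unique xs → All P xs → length xs ≤ count P?
  count-intro P? [] [] = z≤n
  count-intro P? {x ∷ xs} (x∉xs ∷ unique) (px ∷ pxs) =
    ≤-trans (+-mono-≤ (≤-trans (𝟙-true (x ≟ x) refl) (f[i]≤sum (𝟙 ∘ (x ≟_)) x))
                      (count-intro (P? ∖ x) unique (All.zip (pxs , x∉xs))))
            (count-disjoint (x ≟_) (P? ∖ x) P? (λ { refl → px }) proj₁ (λ { refl (_ , x≢x) → x≢x refl }))

  count-elim : ∀ m {P : Pred (Fin n) 0ℓ} (P? : Decidable P) → m ≤ count P? →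
               ∃ λ xs → length xs ≡ m × Unique xs × All P xs
  count-elim zero    P? _ = [] , refl , [] , []
  count-elim (suc m) {P} P? m<count with any? P?
  ... | no ∄ = contradiction (≤-trans m<count (≤-reflexive (count-empty P? λ p → ∄ (_ , p)))) λ ()
  ... | yes (x , px) with count-elim m (P? ∖ x) (s≤s⁻¹ (≤-trans m<count count≤))
    where
    count≤ : count P? ≤ 1 + count (P? ∖ x)
    count≤ = ≤-trans (count-⊎ P? (x ≟_) (P? ∖ x) split) (+-monoˡ-≤ _ (count-≟ x))
      where
      split : ∀ {i} → P i → x ≡ i ⊎ (P i × x ≢ i)
      split {i} pi with x ≟ i
      ... | yes x≡i = inj₁ x≡i
      ... | no x≢i  = inj₂ (pi , x≢i)
  ...   | xs , len , unique , all = x ∷ xs , cong suc len , All.map proj₂ all ∷ unique , px ∷ All.map proj₁ all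

  vec-count : {P : Pred (Fin n) 0ℓ} (P? : Decidable P) → ∀ {m} (f : Fin m → Fin n) →
              Vec.count P? (Vec.tabulate f) ≡ count (P? ∘ f)
  vec-count P? {zero}  f = refl
  vec-count P? {suc m} f with P? (f zero)
  ... | yes _ = cong suc (vec-count P? (f ∘ suc))
  ... | no _  = vec-count P? (f ∘ suc)

  -- Double counting of related pairs: by rows, each `i` in `B` occurs at least once; by columns,
  -- each `j` in `T` occurs at most `m` times.
  charging : {B T : Pred (Fin n) 0ℓ} {R : Fin n → Fin n → Set}
             (B? : Decidable B) (T? : Decidable T) (R? : ∀ i j → Dec (R i j)) (m : ℕ) →
             (∀ {i} → B i → ∃ λ j → T j × R i j) →
             (∀ j → T j → count (λ i → B? i ×-dec R? i j) ≤ m) →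
             count B? ≤ m * count T?
  charging {B} {T} {R} B? T? R? m charge bound = begin
    count B?                              ≤⟨ sum-mono row ⟩
    sum (λ i → sum (λ j → 𝟙 (C? i j)))   ≡⟨ ∑-comm (λ i j → 𝟙 (C? i j)) ⟩
    sum (λ j → sum (λ i → 𝟙 (C? i j)))   ≤⟨ sum-mono column ⟩
    sum (λ j → m * 𝟙 (T? j))             ≡⟨ *-sum m (𝟙 ∘ T?) ⟩
    m * count T?                          ∎
    where
    open ≤-Reasoning
    C? : ∀ i j → Dec ((B i × R i j) × T j)
    C? i j = (B? i ×-dec R? i j) ×-dec T? j
    row : ∀ i → 𝟙 (B? i) ≤ sum (λ j → 𝟙 (C? i j))
    row i = 𝟙≤ (B? i) λ b → let j , t , r = charge b in
      ≤-trans (𝟙-true (C? i j) ((b , r) , t)) (f[i]≤sum (λ j → 𝟙 (C? i j)) j)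
    column : ∀ j → sum (λ i → 𝟙 (C? i j)) ≤ m * 𝟙 (T? j)
    column j with T? j
    ... | no ¬t = ≤-trans (≤-reflexive (count-empty (λ i → (B? i ×-dec R? i j) ×-dec no ¬t) (¬t ∘ proj₂))) z≤n
    ... | yes t = ≤-trans (count-mono (λ i → (B? i ×-dec R? i j) ×-dec yes t) (λ i → B? i ×-dec R? i j) proj₁)
                          (≤-trans (bound j t) (≤-reflexive (sym (*-identityʳ m))))

-- Bounding the game value by single moves.

module Value {n} (G : Graph n) (noIsolated : Graph.NoIsolatedVertices G) where
  open Graph G
  open TotalDominationGame G noIsolated public using (value; someLegalMove)

  ∈-legalMoves : ∀ {S v} → Legal S v → Any.Any (λ m → proj₁ m ≡ v) (legalMoves S)
  ∈-legalMoves {S} {v} legal =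
    Any.mapMaybe⁺ move? (allFin n) (Any.map⁺ (Any.map (λ { refl → found legal }) (∈-allFin v)))
    where
    move? : ∀ u → Maybe.Maybe (∃ (Legal S))
    move? u = Maybe.map (u ,_) (dec⇒maybe (legal? S u))
    found : ∀ {u} → Legal S u → MaybeAny.Any (λ m → proj₁ m ≡ u) (move? u)
    found {u} legal with legal? S u
    ... | yes _     = MaybeAny.just refl
    ... | no ¬legal = contradiction legal ¬legal

  -- Dominator takes a minimum, so one good candidate suffices. The bound is asked for every
  -- accessibility proof, because `value` passes on one of its own.
  value-some-move : ∀ {S v N} → Legal S v →
    (∀ a → 4 * suc (value staller (S ∪ ⁅ v ⁆) a) ≤ N) →
    ∀ a → 4 * value dominator S a ≤ N
  value-some-move {S} legal bound (acc larger) with totalDominatingSet? S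
  ... | yes _ = z≤n
  -- The list entry agrees with the given move in its vertex only; its legality proof may differ.
  ... | no _ with find (∈-legalMoves legal)
  ...   | (_ , legal′) , m∈ , refl =
    ≤-trans (*-monoʳ-≤ 4 (s≤s (min≤v⁺ _ _ (inj₂ (lose (∈-map⁺ _ m∈) ≤-refl)))))
            (bound (larger (legal⇒⊃ legal′)))

  -- Every candidate, including the default from `someLegalMove`, comes from a legal move, so the
  -- bound covers a minimum and a maximum alike.
  value-all-moves : ∀ p {S N} →
    (∀ {v} → Legal S v → ∀ a → 4 * suc (value (opponent p) (S ∪ ⁅ v ⁆) a) ≤ N) →
    ∀ a → 4 * value p S a ≤ N
  value-all-moves p {S} {N} bound (acc larger) with totalDominatingSet? S
  ... | yes _ = z≤n
  ... | no ¬tds = best-all p (after (someLegalMove S ¬tds)) (All.map⁺ (All.universal after _))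
    where
    after : ((v , legal) : ∃ (Legal S)) → 4 * suc (value (opponent p) (S ∪ ⁅ v ⁆) (larger (legal⇒⊃ legal))) ≤ N
    after (v , legal) = bound legal (larger (legal⇒⊃ legal))
    best-all : ∀ q {m ms} → 4 * suc m ≤ N → All (λ k → 4 * suc k ≤ N) ms → 4 * suc (best q m ms) ≤ N
    best-all dominator = argmin-all id
    best-all staller   = argmax-all id

-- Accounting at a single vertex: `L` and `A` stand for legal and endangered before a move, `L′` and
-- `A′` for the same after it, `W` for weakened, `R` for relieved. New endangerment is paid for by
-- lost legality or by `W`; `R` marks a loss that no new endangerment offsets.
𝟙-trade : {L L′ A A′ W R : Set}
  (L? : Dec L) (L′? : Dec L′) (A? : Dec A) (A′? : Dec A′) (W? : Dec W) (R? : Dec R) →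
  (L′ → L) → (A′ → A ⊎ (L × ¬ L′) ⊎ W) → (R → (A × ¬ A′) ⊎ (L × ¬ L′ × (A′ → A))) →
  𝟙 L′? + 𝟙 A′? + 𝟙 R? ≤ 𝟙 L? + 𝟙 A? + 𝟙 W?
𝟙-trade (no ¬l) (yes l′) _ _ _ _ mono _ _ = contradiction (mono l′) ¬l
𝟙-trade (yes l) (yes l′) (yes _) (no _) W? R? _ _ _ = s≤s (≤-trans (𝟙≤1 R?) (s≤s z≤n))
𝟙-trade (yes l) (yes l′) (yes a) (yes a′) W? (yes r) _ _ rel with rel r
... | inj₁ (_ , ¬a′)      = contradiction a′ ¬a′
... | inj₂ (_ , ¬l′ , _)  = contradiction l′ ¬l′
𝟙-trade (yes l) (yes l′) (yes a) (yes a′) W? (no _) _ _ _ = s≤s (s≤s z≤n)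
𝟙-trade (yes l) (yes l′) (no ¬a) A′? W? (yes r) _ _ rel with rel r
... | inj₁ (a , _)        = contradiction a ¬a
... | inj₂ (_ , ¬l′ , _)  = contradiction l′ ¬l′
𝟙-trade (yes l) (yes l′) (no ¬a) (no _) W? (no _) _ _ _ = s≤s z≤n
𝟙-trade (yes l) (yes l′) (no ¬a) (yes a′) W? (no _) _ new _ with new a′
... | inj₁ a                = contradiction a ¬a
... | inj₂ (inj₁ (_ , ¬l′)) = contradiction l′ ¬l′
... | inj₂ (inj₂ w)         = s≤s (𝟙-true W? w)
𝟙-trade (yes l) (no ¬l′) (yes a) A′? W? R? _ _ _ = +-mono-≤ (𝟙≤1 A′?) (≤-trans (𝟙≤1 R?) (s≤s z≤n))
𝟙-trade (yes l) (no ¬l′) (no ¬a) (no _) W? R? _ _ _ = ≤-trans (𝟙≤1 R?) (s≤s z≤n)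
𝟙-trade (yes l) (no ¬l′) (no ¬a) (yes a′) W? (no _) _ _ _ = s≤s z≤n
𝟙-trade (yes l) (no ¬l′) (no ¬a) (yes a′) W? (yes r) _ _ rel with rel r
... | inj₁ (a , _)     = contradiction a ¬a
... | inj₂ (_ , _ , f) = contradiction (f a′) ¬a
𝟙-trade (no ¬l) (no _) A? (no _) W? (yes r) _ _ rel with rel r
... | inj₁ (a , _) = ≤-trans (𝟙-true A? a) (m≤m+n _ _)
... | inj₂ (l , _) = contradiction l ¬l
𝟙-trade (no ¬l) (no _) A? (no _) W? (no _) _ _ _ = z≤n
𝟙-trade (no ¬l) (no _) A? (yes a′) W? (yes r) _ _ rel with rel r
... | inj₁ (_ , ¬a′) = contradiction a′ ¬a′
... | inj₂ (l , _)   = contradiction l ¬l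
𝟙-trade (no ¬l) (no _) A? (yes a′) W? (no _) _ new _ with new a′
... | inj₁ a              = ≤-trans (𝟙-true A? a) (m≤m+n _ _)
... | inj₂ (inj₁ (l , _)) = contradiction l ¬l
... | inj₂ (inj₂ w)       = ≤-trans (𝟙-true W? w) (m≤n+m _ _)

sum-+₃ : ∀ {n} (f g h : Fin n → ℕ) → sum (λ i → f i + g i + h i) ≡ sum f + sum g + sum h
sum-+₃ f g h = trans (∑-distrib-+ (λ i → f i + g i) h) (cong (_+ sum h) (∑-distrib-+ f g))

module Game {n} (G : Graph n) (noIsolated : Graph.NoIsolatedVertices G)
  (degreeSum : ∀ u v → Graph._~_ G u v → 4 ≤ Graph.degree G u + Graph.degree G v)
  (leafDistance : ∀ u v → Graph.Leaf G u → Graph.Leaf G v → ¬ Graph.Distance G u v 4) where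

  open Graph G
  open Value G noIsolated

  private variable
    S : Subset n
    u v w x y z : Fin n

  -- Leaves and their supports.

  degree≡count : ∀ v → degree v ≡ count (v ~?_)
  degree≡count v = vec-count (v ~?_) id

  ~⇒≢ : u ~ v → u ≢ v
  ~⇒≢ u~v u≡v = ~-irrefl u≡v u~v

  support : Fin n → Fin n
  support w = proj₁ (noIsolated w)

  ~support : ∀ w → w ~ support w
  ~support w = proj₂ (noIsolated w)

  leaf? : Decidable Leaf
  leaf? v = degree v ℕ.≟ 1

  leaf-unique : Leaf w → w ~ x → w ~ y → x ≡ y
  leaf-unique {w} {x} {y} leaf w~x w~y with x ≟ y
  ... | yes x≡y = x≡y
  ... | no x≢y  = contradiction 2≤1 λ { (s≤s ()) }
    where
    2≤1 : 2 ≤ 1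
    2≤1 = subst (2 ≤_) (trans (sym (degree≡count w)) leaf)
            (count-intro (w ~?_) ((x≢y ∷ []) ∷ [] ∷ []) (w~x ∷ w~y ∷ []))

  3≤degree-support : Leaf w → 3 ≤ degree (support w)
  3≤degree-support {w} leaf =
    s≤s⁻¹ (subst (λ d → 4 ≤ d + degree (support w)) leaf (degreeSum w (support w) (~support w)))

  support-not-leaf : Leaf w → ¬ Leaf (support w)
  support-not-leaf leaf leaf′ = contradiction (subst (3 ≤_) leaf′ (3≤degree-support leaf)) λ { (s≤s ()) }

  leaf≢support : Leaf y → Leaf w → y ≢ support w
  leaf≢support leafʸ leafʷ refl = support-not-leaf leafʷ leafʸ

  leaf≁leaf : Leaf y → Leaf w → ¬ y ~ w
  leaf≁leaf {y} leafʸ leafʷ y~w = leaf≢support leafʷ leafʸ (leaf-unique leafʸ y~w (~support y))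

  -- Otherwise the walk through `x` is shortest, since walks of length 0 to 3 force equal leaves,
  -- adjacent leaves, a common support or adjacent supports. The leaves are then at the forbidden
  -- distance 4.
  supports-adjacent : Leaf y → Leaf w → support y ≢ support w →
                      support y ~ x → support w ~ x → support y ~ support w
  supports-adjacent {y} {w} leafʸ leafʷ s≢s s~x s′~x with support y ~? support w
  ... | yes s~s = s~s
  ... | no s≁s  = contradiction (walk , λ {_} → shortest) (leafDistance y w leafʸ leafʷ)
    where
    walk : Walk y w 4
    walk = ~support y ∷ (s~x ∷ (~-sym s′~x ∷ (~-sym (~support w) ∷ [])))
    shortest : ∀ {k} → Walk y w k → 4 ≤ k
    shortest [] = contradiction refl s≢s
    shortest (y~w ∷ []) = contradiction y~w (leaf≁leaf leafʸ leafʷ)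
    shortest (y~v ∷ (v~w ∷ [])) =
      contradiction (trans (leaf-unique leafʸ (~support y) y~v) (leaf-unique leafʷ (~-sym v~w) (~support w))) s≢s
    shortest (y~u ∷ (u~v ∷ (v~w ∷ [])))
      with refl ← leaf-unique leafʸ y~u (~support y)
         | refl ← leaf-unique leafʷ (~-sym v~w) (~support w) = contradiction u~v s≁s
    shortest (_ ∷ (_ ∷ (_ ∷ (_ ∷ _)))) = s≤s (s≤s (s≤s (s≤s z≤n)))

  -- Undominated vertices and the gain of a move.

  Undominated : Subset n → Fin n → Set
  Undominated S y = ¬ TotallyDominated S y

  undominated? : ∀ S → Decidable (Undominated S)
  undominated? S y = ¬? (totallyDominated? S y)

  dominated⁺ˡ : TotallyDominated S y → TotallyDominated (S ∪ ⁅ z ⁆) y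
  dominated⁺ˡ (x , x∈S , x~y) = x , x∈p∪q⁺ (inj₁ x∈S) , x~y

  dominated⁺ʳ : z ~ y → TotallyDominated (S ∪ ⁅ z ⁆) y
  dominated⁺ʳ {z} z~y = z , x∈p∪q⁺ (inj₂ (x∈⁅x⁆ z)) , z~y

  dominated⁻ : TotallyDominated (S ∪ ⁅ z ⁆) y → TotallyDominated S y ⊎ z ~ y
  dominated⁻ {S} {z} (x , x∈ , x~y) with x∈p∪q⁻ S ⁅ z ⁆ x∈
  ... | inj₁ x∈S = inj₁ (x , x∈S , x~y)
  ... | inj₂ x∈z with refl ← x∈⁅y⁆⇒x≡y z x∈z = inj₂ x~y

  New : Subset n → Fin n → Fin n → Set
  New S v y = v ~ y × Undominated S y

  new? : ∀ S v → Decidable (New S v)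
  new? S v y = v ~? y ×-dec undominated? S y

  gain : Subset n → Fin n → ℕ
  gain S v = count (new? S v)

  gain-after-≤ : ∀ S z u → gain (S ∪ ⁅ z ⁆) u ≤ gain S u
  gain-after-≤ S z u = count-mono (new? (S ∪ ⁅ z ⁆) u) (new? S u) λ (u~y , ud) → u~y , ud ∘ dominated⁺ˡ

  gain-after-≥ : ∀ S z u → gain S u ≤ gain (S ∪ ⁅ z ⁆) u + gain S z
  gain-after-≥ S z u = count-⊎ (new? S u) (new? (S ∪ ⁅ z ⁆) u) (new? S z) split
    where
    split : New S u y → New (S ∪ ⁅ z ⁆) u y ⊎ New S z y
    split {y} (u~y , ud) with z ~? y
    ... | yes z~y = inj₂ (z~y , ud)
    ... | no z≁y  = inj₁ (u~y , [ ud , z≁y ]′ ∘ dominated⁻)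

  gain-lost : gain (S ∪ ⁅ z ⁆) u < gain S u → ∃ λ x → New S z x × u ~ x
  gain-lost {S} {z} {u} less with any? (λ x → new? S z x ×-dec u ~? x)
  ... | yes found = found
  ... | no none   = contradiction (≤-trans less kept) ℕ.1+n≰n
    where
    kept : gain S u ≤ gain (S ∪ ⁅ z ⁆) u
    kept = count-mono (new? S u) (new? (S ∪ ⁅ z ⁆) u)
      λ (u~y , ud) → u~y , [ ud , (λ z~y → none (_ , (z~y , ud) , u~y)) ]′ ∘ dominated⁻

  -- The weight and its drop in one move.

  Endangered : Subset n → Fin n → Set
  Endangered S w = Leaf w × Undominated S w × (TotallyDominated S (support w) ⊎ gain S (support w) ≤ 2)

  endangered? : ∀ S → Decidable (Endangered S)
  endangered? S w = leaf? w ×-dec undominated? S w ×-dec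
    (totallyDominated? S (support w) ⊎-dec gain S (support w) ℕ.≤? 2)

  weight : Subset n → ℕ
  weight S = 2 * count (undominated? S) + (count (legal? S) + count (endangered? S))

  -- These are the vertices whose own share of the legal and endangered counts falls. The last
  -- clause of the second case excludes that a lost legal move is offset by new endangerment.
  Relieved : Subset n → Fin n → Fin n → Set
  Relieved S z y = let S′ = S ∪ ⁅ z ⁆ in
    (Endangered S y × ¬ Endangered S′ y) ⊎
    (Legal S y × ¬ Legal S′ y × (Endangered S′ y → Endangered S y))

  relieved? : ∀ S z → Decidable (Relieved S z)
  relieved? S z y = let S′ = S ∪ ⁅ z ⁆ in
    (endangered? S y ×-dec ¬? (endangered? S′ y)) ⊎-dec
    (legal? S y ×-dec ¬? (legal? S′ y) ×-dec (endangered? S′ y →-dec endangered? S y))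

  -- A leaf that becomes endangered without being weakened stops being a legal move,
  -- so that its own contribution to the weight does not grow.
  Weakened : Subset n → Fin n → Fin n → Set
  Weakened S z y = let S′ = S ∪ ⁅ z ⁆ in
    Leaf y × Undominated S′ y × Undominated S′ (support y) ×
    3 ≤ gain S (support y) × gain S′ (support y) ≤ 2

  weakened? : ∀ S z → Decidable (Weakened S z)
  weakened? S z y = let S′ = S ∪ ⁅ z ⁆ in
    leaf? y ×-dec undominated? S′ y ×-dec undominated? S′ (support y) ×-dec
    3 ℕ.≤? gain S (support y) ×-dec gain S′ (support y) ℕ.≤? 2

  leaf-illegal : Leaf y → TotallyDominated S (support y) → ¬ Legal S y
  leaf-illegal {y} {S} leaf dom (x , y~x , ud) =
    ud (subst (TotallyDominated S) (leaf-unique leaf (~support y) y~x) dom)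

  -- The undominated count falls by at least `gain S z`; the other two counts are compared vertex by
  -- vertex through `𝟙-trade`. Only weakened leaves work against the drop.
  weight-drop : ∀ S z → weight (S ∪ ⁅ z ⁆) + (2 * gain S z + count (relieved? S z))
                        ≤ weight S + count (weakened? S z)
  weight-drop S z = begin
    2 * U′ + (L′ + E′) + (2 * K + R)   ≡⟨ regroup U′ L′ E′ K R ⟩
    2 * (U′ + K) + (L′ + E′ + R)       ≤⟨ +-mono-≤ (*-monoʳ-≤ 2 undominated) rest ⟩
    2 * U + (L + E + W)                ≡⟨ regroup′ U L E W ⟩
    2 * U + (L + E) + W                ∎
    where
    open ≤-Reasoning
    S′ = S ∪ ⁅ z ⁆
    U = count (undominated? S)
    U′ = count (undominated? S′)
    L = count (legal? S)
    L′ = count (legal? S′)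
    E = count (endangered? S)
    E′ = count (endangered? S′)
    K = gain S z
    R = count (relieved? S z)
    W = count (weakened? S z)
    regroup : ∀ u l e k r → 2 * u + (l + e) + (2 * k + r) ≡ 2 * (u + k) + (l + e + r)
    regroup = solve-∀
    regroup′ : ∀ u l e w → 2 * u + (l + e + w) ≡ 2 * u + (l + e) + w
    regroup′ = solve-∀
    undominated : U′ + K ≤ U
    undominated = count-disjoint (undominated? S′) (new? S z) (undominated? S)
      (_∘ dominated⁺ˡ) proj₂ (λ ud′ (z~y , _) → ud′ (dominated⁺ʳ z~y))
    -- If the support of a newly endangered leaf is dominated now, it was not before, so the leaf
    -- stops being legal; otherwise the gain of the support fell from at least 3 to at most 2.
    newly : Endangered S′ y → Endangered S y ⊎ (Legal S y × ¬ Legal S′ y) ⊎ Weakened S z y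
    newly {y} (leaf , ud′ , cause) with endangered? S y
    ... | yes e = inj₁ e
    ... | no ¬e with totallyDominated? S′ (support y)
    ...   | yes dom′ = inj₂ (inj₁ ((support y , ~support y , λ dom → ¬e (leaf , ud′ ∘ dominated⁺ˡ , inj₁ dom))
                                 , leaf-illegal leaf dom′))
    ...   | no ¬dom′ = inj₂ (inj₂ (leaf , ud′ , ¬dom′
                                 , ℕ.≰⇒> (λ ≤2 → ¬e (leaf , ud′ ∘ dominated⁺ˡ , inj₂ ≤2))
                                 , [ flip contradiction ¬dom′ , id ]′ cause))
    rest : L′ + E′ + R ≤ L + E + W
    rest = begin
      L′ + E′ + R  ≡⟨ sum-+₃ (𝟙 ∘ legal? S′) (𝟙 ∘ endangered? S′) (𝟙 ∘ relieved? S z) ⟨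
      sum (λ y → 𝟙 (legal? S′ y) + 𝟙 (endangered? S′ y) + 𝟙 (relieved? S z y))
        ≤⟨ sum-mono (λ y → 𝟙-trade (legal? S y) (legal? S′ y) (endangered? S y) (endangered? S′ y)
                             (weakened? S z y) (relieved? S z y)
                             (λ (x , y~x , ud′) → x , y~x , ud′ ∘ dominated⁺ˡ) newly id) ⟩
      sum (λ y → 𝟙 (legal? S y) + 𝟙 (endangered? S y) + 𝟙 (weakened? S z y))
        ≡⟨ sum-+₃ (𝟙 ∘ legal? S) (𝟙 ∘ endangered? S) (𝟙 ∘ weakened? S z) ⟩
      L + E + W ∎

  illegal-after : (∀ {y} → x ~ y → TotallyDominated S y) → ¬ Legal S x
  illegal-after dom (y , x~y , ud) = ud (dom x~y)

  -- Once played, `z` has only dominated neighbours and is no longer legal; only its becoming newly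
  -- endangered could offset that loss.
  relieved-move : Legal S z → (Endangered (S ∪ ⁅ z ⁆) z → Endangered S z) → Relieved S z z
  relieved-move legal back = inj₂ (legal , illegal-after dominated⁺ʳ , back)

  relieved-dominated : Endangered S y → z ~ y → Relieved S z y
  relieved-dominated e z~y = inj₁ (e , λ (_ , ud′ , _) → ud′ (dominated⁺ʳ z~y))

  relieved-leaf : Legal S y → Endangered S y → z ~ support y → Relieved S z y
  relieved-leaf legal e@(leaf , _) z~s =
    inj₂ (legal , leaf-illegal leaf (dominated⁺ʳ z~s) , λ _ → e)

  gain⇒legal : 1 ≤ gain S v → Legal S v
  gain⇒legal {S} {v} 1≤gain with count-elim 1 (new? S v) 1≤gain
  ... | x ∷ [] , refl , _ , new ∷ _ = x , new

  legal⇒gain : Legal S v → 1 ≤ gain S v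
  legal⇒gain {S} {v} (x , new) = count-intro (new? S v) ([] ∷ []) (new ∷ [])

  drop-without-weakening : ∀ {g xs} → g ≤ gain S z → (∀ {y} → ¬ Weakened S z y) →
    Unique xs → All (Relieved S z) xs →
    weight (S ∪ ⁅ z ⁆) + (2 * g + length xs) ≤ weight S
  drop-without-weakening {S} {z} {g} {xs} g≤gain ¬weak unique relieved = begin
    weight (S ∪ ⁅ z ⁆) + (2 * g + length xs)
      ≤⟨ +-monoʳ-≤ (weight (S ∪ ⁅ z ⁆))
           (+-mono-≤ (*-monoʳ-≤ 2 g≤gain) (count-intro (relieved? S z) unique relieved)) ⟩
    weight (S ∪ ⁅ z ⁆) + (2 * gain S z + count (relieved? S z))
      ≤⟨ weight-drop S z ⟩
    weight S + count (weakened? S z)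
      ≡⟨ cong (weight S +_) (count-empty (weakened? S z) ¬weak) ⟩
    weight S + 0
      ≡⟨ ℕ.+-identityʳ (weight S) ⟩
    weight S ∎
    where open ≤-Reasoning

  -- Another support vertex that loses a neighbour to this move is adjacent to
  -- support w, hence dominated by the move itself.
  support-weakens-none : Leaf w → ¬ Weakened S (support w) y
  support-weakens-none {w} {S} {y} leafʷ (leafʸ , ud , ud-s , 3≤ , ≤2)
    with gain-lost {S} {support w} {support y} (≤-trans (s≤s ≤2) 3≤)
  ... | x , (s~x , _) , s′~x = ud-s (dominated⁺ʳ (supports-adjacent leafʷ leafʸ s≢s s~x s′~x))
    where
    s≢s : support w ≢ support y
    s≢s eq = ud (dominated⁺ʳ (subst (_~ y) (sym eq) (~-sym (~support y))))

  support-legal : ∀ w → Undominated S w → Legal S (support w)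
  support-legal w ud = w , ~-sym (~support w) , ud

  support-relieved : Leaf w → Undominated S w → Relieved S (support w) (support w)
  support-relieved {w} leaf ud = relieved-move (support-legal w ud) λ (leaf′ , _) →
    contradiction leaf′ (support-not-leaf leaf)

  -- The extra 1 comes from the support itself: it stops being legal and, not being a leaf, cannot
  -- become endangered.
  support-drop : ∀ {g xs} → Leaf w → Undominated S w → g ≤ gain S (support w) →
    Unique (support w ∷ xs) → All (Relieved S (support w)) xs →
    weight (S ∪ ⁅ support w ⁆) + (2 * g + suc (length xs)) ≤ weight S
  support-drop leaf ud g≤gain unique relieved =
    drop-without-weakening g≤gain (support-weakens-none leaf) unique (support-relieved leaf ud ∷ relieved)

  endangered-before : gain S (support w) ≤ 2 → Endangered (S ∪ ⁅ z ⁆) w → Endangered S w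
  endangered-before ≤2 (leaf , ud′ , _) = leaf , ud′ ∘ dominated⁺ˡ , inj₂ ≤2

  weakened⇒endangered : Weakened S z y → Endangered (S ∪ ⁅ z ⁆) y
  weakened⇒endangered (leaf , ud , _ , _ , ≤2) = leaf , ud , inj₂ ≤2

  other-neighbour : ∀ x z → ¬ Leaf x → x ~ z → ∃ λ v → x ~ v × z ≢ v
  other-neighbour x z ¬leaf x~z with any? (λ v → x ~? v ×-dec ¬? (z ≟ v))
  ... | yes found = found
  ... | no none   = contradiction (ℕ.≤-antisym ≤1 ≥1) ¬leaf
    where
    only : ∀ {v} → x ~ v → z ≡ v
    only {v} x~v = decidable-stable (z ≟ v) λ z≢v → none (v , x~v , z≢v)
    ≤1 : degree x ≤ 1
    ≤1 = subst (_≤ 1) (sym (degree≡count x)) (≤-trans (count-mono (x ~?_) (z ≟_) only) (count-≟ z))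
    ≥1 : 1 ≤ degree x
    ≥1 = subst (1 ≤_) (sym (degree≡count x)) (count-intro (x ~?_) ([] ∷ []) (x~z ∷ []))

  -- Positions in which every move dominates at most one new vertex.

  Sparse : Subset n → Set
  Sparse S = ∀ v → gain S v ≤ 1

  module SparseDrop {S z} (sparse : Sparse S) (legal : Legal S z) where

    gain≤2 : gain S v ≤ 2
    gain≤2 {v} = ≤-trans (sparse v) (ℕ.n≤1+n 1)

    -- The 4 is twice the one newly dominated vertex plus two relieved ones, `z` and `y`. No leaf is
    -- weakened, since that needs a gain of 3 beforehand.
    drop : z ≢ y → Relieved S z y → weight (S ∪ ⁅ z ⁆) + 4 ≤ weight S
    drop z≢y relieved = drop-without-weakening (legal⇒gain legal)
      (λ (_ , _ , _ , 3≤ , _) → ℕ.1+n≰n (≤-trans 3≤ gain≤2))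
      ((z≢y ∷ []) ∷ [] ∷ []) (relieved-move legal (endangered-before gain≤2) ∷ relieved ∷ [])

    -- By sparsity `x` is the only vertex that `v` could newly dominate, so `v` stops being legal
    -- once `x` is dominated.
    relieved-other : let x = proj₁ legal in x ~ v → Relieved S z v
    relieved-other {v} x~v = let x , z~x , ud = legal in inj₂
      ( (x , ~-sym x~v , ud)
      , illegal-after (λ {y} v~y → decidable-stable (totallyDominated? (S ∪ ⁅ z ⁆) y) λ ud′ →
          ud′ (subst (TotallyDominated _) (unique-new (v~y , ud′ ∘ dominated⁺ˡ)) (dominated⁺ʳ z~x)))
      , endangered-before gain≤2)
      where
      unique-new : New S v y → proj₁ legal ≡ y
      unique-new {y} new = decidable-stable (proj₁ legal ≟ y) λ x≢y → ℕ.1+n≰n (≤-trans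
        (count-intro (new? S v) ((x≢y ∷ []) ∷ [] ∷ []) ((~-sym x~v , proj₂ (proj₂ legal)) ∷ new ∷ []))
        (sparse v))

  -- The second relieved vertex is the newly dominated `x` if it is a leaf, which small gains make
  -- endangered, and another neighbour of `x` otherwise.
  sparse-drop : Sparse S → Legal S z → weight (S ∪ ⁅ z ⁆) + 4 ≤ weight S
  sparse-drop {S} {z} sparse legal@(x , z~x , ud) with leaf? x
  ... | yes leaf = drop (~⇒≢ z~x) (relieved-dominated (leaf , ud , inj₂ gain≤2) z~x)
    where open SparseDrop sparse legal
  ... | no ¬leaf with v , x~v , z≢v ← other-neighbour x z ¬leaf (~-sym z~x) = drop z≢v (relieved-other x~v)
    where open SparseDrop sparse legal

  sparse-bound : ∀ S → Sparse S → ∀ p a → 4 * value p S a ≤ weight S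
  sparse-bound = All.wfRec ⊃-wellFounded _ (λ S → Sparse S → ∀ p a → 4 * value p S a ≤ weight S) step
    where
    step : ∀ S → (∀ {S′} → S′ ⊃ S → Sparse S′ → ∀ p a → 4 * value p S′ a ≤ weight S′) →
           Sparse S → ∀ p a → 4 * value p S a ≤ weight S
    step S ih sparse p = value-all-moves p λ {v} legal a → begin
      4 * suc (value (opponent p) (S ∪ ⁅ v ⁆) a)   ≡⟨ ℕ.*-suc 4 _ ⟩
      4 + 4 * value (opponent p) (S ∪ ⁅ v ⁆) a     ≤⟨ +-monoʳ-≤ 4 (ih (legal⇒⊃ legal) (sparse-after v) (opponent p) a) ⟩
      4 + weight (S ∪ ⁅ v ⁆)                       ≡⟨ ℕ.+-comm 4 _ ⟩
      weight (S ∪ ⁅ v ⁆) + 4                       ≤⟨ sparse-drop sparse legal ⟩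
      weight S                                     ∎
      where
      open ≤-Reasoning
      sparse-after : ∀ v → Sparse (S ∪ ⁅ v ⁆)
      sparse-after v u = ≤-trans (gain-after-≤ S v u) (sparse u)

  -- Charging weakened leaves to newly dominated vertices.

  Charged : Subset n → Fin n → Fin n → Fin n → Set
  Charged S z x y = Weakened S z y × support y ~ x

  charged? : ∀ S z x → Decidable (Charged S z x)
  charged? S z x y = weakened? S z y ×-dec support y ~? x

  weakened-charged : Weakened S z y → ∃ λ x → New S z x × support y ~ x
  weakened-charged (_ , _ , _ , 3≤ , ≤2) = gain-lost (≤-trans (s≤s ≤2) 3≤)

  -- Distinct supports share the neighbour `x` and so are adjacent; the support of a weakened leaf
  -- is still undominated and counts towards the gain of the other.
  charged-pair : Charged S z x y → Charged S z x w →
    support y ≡ support w ⊎ (support y ≢ support w × New (S ∪ ⁅ z ⁆) (support y) (support w))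
  charged-pair {y = y} {w} ((leafʸ , _) , s~x) ((leafʷ , _ , ud , _) , s′~x) with support y ≟ support w
  ... | yes s≡s = inj₁ s≡s
  ... | no s≢s  = inj₂ (s≢s , supports-adjacent leafʸ leafʷ s≢s s~x s′~x , ud)

  charged-new : Charged S z x y → New (S ∪ ⁅ z ⁆) (support y) y
  charged-new {y = y} ((_ , ud , _) , _) = ~-sym (~support y) , ud

  new-three : y ≢ w → y ≢ v → w ≢ v → New S u y → New S u w → New S u v → ¬ gain S u ≤ 2
  new-three {S = S} {u} y≢w y≢v w≢v ny nw nv ≤2 = ℕ.1+n≰n (≤-trans
    (count-intro (new? S u) ((y≢w ∷ y≢v ∷ []) ∷ (w≢v ∷ []) ∷ [] ∷ []) (ny ∷ nw ∷ nv ∷ [])) ≤2)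

  leaf≢support′ : Charged S z x y → Charged S z x w → y ≢ support w
  leaf≢support′ ((leafʸ , _) , _) ((leafʷ , _) , _) = leaf≢support leafʸ leafʷ

  -- The supports of leaves charged to the same vertex are pairwise adjacent and
  -- undominated, so three such leaves would leave one support with gain 3.
  no-three-charged : Charged S z x y → Charged S z x w → Charged S z x v → y ≢ w → y ≢ v → ¬ w ≢ v
  no-three-charged {y = y} {w} {v} cy cw@((_ , _ , _ , _ , ≤2w) , _) cv y≢w y≢v w≢v
    with charged-pair cw cv
  ... | inj₁ sw≡sv with charged-pair cw cy
  ...   | inj₁ sw≡sy      = new-three (≢-sym y≢w) w≢v y≢v (charged-new cw)
                              (subst (λ u → New _ u y) (sym sw≡sy) (charged-new cy))
                              (subst (λ u → New _ u v) (sym sw≡sv) (charged-new cv)) ≤2w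
  ...   | inj₂ (_ , new)  = new-three w≢v (leaf≢support′ cw cy) (leaf≢support′ cv cy) (charged-new cw)
                              (subst (λ u → New _ u v) (sym sw≡sv) (charged-new cv)) new ≤2w
  no-three-charged {y = y} {w} {v} cy@((_ , _ , _ , _ , ≤2y) , _) cw cv y≢w y≢v w≢v
      | inj₂ (sw≢sv , _) with charged-pair cy cw | charged-pair cy cv
  ...   | inj₁ sy≡sw     | inj₁ sy≡sv     = sw≢sv (trans (sym sy≡sw) sy≡sv)
  ...   | inj₁ sy≡sw     | inj₂ (_ , new) = new-three y≢w (leaf≢support′ cy cv) (leaf≢support′ cw cv)
                              (charged-new cy) (subst (λ u → New _ u w) (sym sy≡sw) (charged-new cw)) new ≤2y
  ...   | inj₂ (_ , new) | inj₁ sy≡sv     = new-three (leaf≢support′ cy cw) y≢v (≢-sym (leaf≢support′ cv cw))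
                              (charged-new cy) new (subst (λ u → New _ u v) (sym sy≡sv) (charged-new cv)) ≤2y
  ...   | inj₂ (_ , new) | inj₂ (_ , new′) = new-three (leaf≢support′ cy cw) (leaf≢support′ cy cv) sw≢sv
                              (charged-new cy) new new′ ≤2y

  charged≤2 : ∀ S z x → count (charged? S z x) ≤ 2
  charged≤2 S z x = ℕ.≮⇒≥ λ 3≤ → absurd (count-elim 3 (charged? S z x) 3≤)
    where
    absurd : ¬ ∃ λ xs → length xs ≡ 3 × Unique xs × All (Charged S z x) xs
    absurd (_ ∷ _ ∷ _ ∷ [] , refl , (y≢w ∷ y≢v ∷ []) ∷ (w≢v ∷ []) ∷ _ , cy ∷ cw ∷ cv ∷ []) =
      no-three-charged cy cw cv y≢w y≢v w≢v

  -- Each newly dominated vertex yields 2 units and pays for at most `m` weakened leaves. With `m`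
  -- equal to 2 only `r` is sure to remain; with `m` equal to 1, one unit per vertex remains as
  -- well.
  drop-charging : ∀ m {r} → (∀ x → New S z x → count (charged? S z x) ≤ m) → r ≤ count (relieved? S z) →
    weight (S ∪ ⁅ z ⁆) + (2 * gain S z + r) ≤ weight S + m * gain S z
  drop-charging {S} {z} m {r} bound r≤ = begin
    weight (S ∪ ⁅ z ⁆) + (2 * gain S z + r)
      ≤⟨ +-monoʳ-≤ (weight (S ∪ ⁅ z ⁆)) (+-monoʳ-≤ (2 * gain S z) r≤) ⟩
    weight (S ∪ ⁅ z ⁆) + (2 * gain S z + count (relieved? S z))
      ≤⟨ weight-drop S z ⟩
    weight S + count (weakened? S z)
      ≤⟨ +-monoʳ-≤ (weight S)
           (charging (weakened? S z) (new? S z) (λ y x → support y ~? x) m weakened-charged bound) ⟩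
    weight S + m * gain S z ∎
    where open ≤-Reasoning

  drop-charging₂ : ∀ {r} → r ≤ count (relieved? S z) → weight (S ∪ ⁅ z ⁆) + r ≤ weight S
  drop-charging₂ {S} {z} {r} r≤ = ℕ.+-cancelʳ-≤ (2 * gain S z) _ _ (begin
    weight (S ∪ ⁅ z ⁆) + r + 2 * gain S z     ≡⟨ regroup (weight (S ∪ ⁅ z ⁆)) r (2 * gain S z) ⟩
    weight (S ∪ ⁅ z ⁆) + (2 * gain S z + r)   ≤⟨ drop-charging 2 (λ x _ → charged≤2 S z x) r≤ ⟩
    weight S + 2 * gain S z                   ∎)
    where
    open ≤-Reasoning
    regroup : ∀ a b c → a + b + c ≡ a + (c + b)
    regroup = solve-∀

  drop-charging₁ : ∀ {r} → (∀ x → New S z x → count (charged? S z x) ≤ 1) → r ≤ count (relieved? S z) →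
    weight (S ∪ ⁅ z ⁆) + (gain S z + r) ≤ weight S
  drop-charging₁ {S} {z} {r} bound r≤ = ℕ.+-cancelʳ-≤ (1 * gain S z) _ _ (begin
    weight (S ∪ ⁅ z ⁆) + (gain S z + r) + 1 * gain S z   ≡⟨ regroup (weight (S ∪ ⁅ z ⁆)) (gain S z) r ⟩
    weight (S ∪ ⁅ z ⁆) + (2 * gain S z + r)              ≤⟨ drop-charging 1 bound r≤ ⟩
    weight S + 1 * gain S z                              ∎)
    where
    open ≤-Reasoning
    regroup : ∀ a b c → a + (b + c) + 1 * b ≡ a + (2 * b + c)
    regroup = solve-∀

  -- Dominator's replies to Staller.

  Reply : Subset n → ℕ → Set
  Reply S d = ∃ λ v → Legal S v × weight (S ∪ ⁅ v ⁆) + d ≤ weight S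

  -- A drop of 3 suffices because the bound for Staller has slack 1. Otherwise move and reply
  -- together must drop 8; `d ≤ 8` keeps the truncated subtraction exact.
  Answered : Subset n → Fin n → Set
  Answered S z = let S′ = S ∪ ⁅ z ⁆ in
    weight S′ + 3 ≤ weight S ⊎ (∃ λ d → weight S′ + (8 ℕ.∸ d) ≤ weight S × d ≤ 8 × Reply S′ d)

  support-reply : ∀ {g xs} w → Leaf w → Undominated S w → g ≤ gain S (support w) →
    Unique (support w ∷ xs) → All (Relieved S (support w)) xs → Reply S (2 * g + suc (length xs))
  support-reply w leaf ud g≤gain unique relieved =
    support w , support-legal w ud , support-drop leaf ud g≤gain unique relieved

  -- The 2 counts the support, which stops being legal, and the leaf, which is dominated and so no
  -- longer endangered.
  endangered-reply : ∀ {g} → Endangered S w → g ≤ gain S (support w) → Reply S (2 * g + 2)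
  endangered-reply {S} {w} e@(leaf , ud , _) g≤gain =
    support-reply w leaf ud g≤gain ((≢-sym (~⇒≢ (~support w)) ∷ []) ∷ [] ∷ [])
      (relieved-dominated e (~-sym (~support w)) ∷ [])

  -- The 7 is twice a gain of 2 plus three relieved vertices: the support of `y`, `y` and `w`.
  -- Besides `y`, the move dominates `w` if the supports coincide, and the support of `w` otherwise.
  pair-reply : Charged S z x y → Charged S z x w → y ≢ w → Reply (S ∪ ⁅ z ⁆) 7
  pair-reply {S} {z} {x} {y} {w} cy@(weakʸ@(leafʸ , udʸ , _) , _) cw@(weakʷ , _) y≢w =
    support-reply y leafʸ udʸ 2≤gain
      ((≢-sym (leaf≢support′ cy cy) ∷ ≢-sym (leaf≢support′ cw cy) ∷ []) ∷ (y≢w ∷ []) ∷ [] ∷ [])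
      (relieved-dominated (weakened⇒endangered weakʸ) (~-sym (~support y)) ∷ relieved-w ∷ [])
    where
    S′ = S ∪ ⁅ z ⁆
    e : Endangered S′ w
    e = weakened⇒endangered weakʷ
    2≤gain : 2 ≤ gain S′ (support y)
    2≤gain with charged-pair cy cw
    ... | inj₁ s≡s       = count-intro (new? S′ (support y)) ((y≢w ∷ []) ∷ [] ∷ [])
                             (charged-new cy ∷ subst (λ u → New _ u w) (sym s≡s) (charged-new cw) ∷ [])
    ... | inj₂ (_ , new) = count-intro (new? S′ (support y)) ((leaf≢support′ cy cw ∷ []) ∷ [] ∷ [])
                             (charged-new cy ∷ new ∷ [])
    relieved-w : Relieved S′ (support y) w
    relieved-w with charged-pair cy cw
    ... | inj₁ s≡s              = relieved-dominated e (subst (_~ w) (sym s≡s) (~-sym (~support w)))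
    -- Here `w` stays undominated, but its only neighbour becomes dominated, so `w` stops being
    -- legal.
    ... | inj₂ (_ , s~s′ , ud) = relieved-leaf (support w , ~support w , ud) e s~s′

  answer-charged : Relieved S z z → Legal S z → Answered S z
  answer-charged {S} {z} relieved legal with any? (λ x → new? S z x ×-dec 2 ℕ.≤? count (charged? S z x))
  ... | yes (x , _ , 2≤) with count-elim 2 (charged? S z x) 2≤
  ...   | _ ∷ _ ∷ [] , refl , (y≢w ∷ []) ∷ _ , cy ∷ cw ∷ [] =
    -- Charging may consume all of the gain; the relieved `z` leaves the 1 that complements 7.
    inj₂ (7 , drop-charging₂ (count-intro (relieved? S z) ([] ∷ []) (relieved ∷ []))
            , ℕ.n≤1+n 7 , pair-reply cy cw y≢w)
  answer-charged {S} {z} relieved legal | no none = by-gain (ℕ.m≤n⇒m<n∨m≡n (legal⇒gain legal))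
    where
    bound : ∀ x → New S z x → count (charged? S z x) ≤ 1
    bound x new = s≤s⁻¹ (ℕ.≰⇒> λ 2≤ → none (x , new , 2≤))
    1≤relieved : 1 ≤ count (relieved? S z)
    1≤relieved = count-intro (relieved? S z) ([] ∷ []) (relieved ∷ [])
    by-gain : 2 ≤ gain S z ⊎ 1 ≡ gain S z → Answered S z
    by-gain (inj₁ 2≤gain) = inj₁ (≤-trans (+-monoʳ-≤ (weight (S ∪ ⁅ z ⁆)) (+-monoˡ-≤ 1 2≤gain))
                                          (drop-charging₁ bound 1≤relieved))
    by-gain (inj₂ 1≡gain) with any? (weakened? S z)
    ... | no ¬weak = inj₁ (drop-without-weakening (legal⇒gain legal) (λ weak → ¬weak (_ , weak))
                             ([] ∷ []) (relieved ∷ []))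
    ... | yes (y , weak@(_ , _ , _ , 3≤ , _)) =
      -- The single new vertex keeps one unit and `z` adds another, a drop of 2. The support keeps a
      -- gain of at least 3 - 1 = 2, so the reply is worth 2 * 2 + 2 = 6.
      inj₂ (6 , subst (λ k → weight (S ∪ ⁅ z ⁆) + (k + 1) ≤ weight S) (sym 1≡gain)
                  (drop-charging₁ bound 1≤relieved)
              , ℕ.m≤m+n 6 2 , endangered-reply (weakened⇒endangered weak) 2≤gain′)
      where
      2≤gain′ : 2 ≤ gain (S ∪ ⁅ z ⁆) (support y)
      2≤gain′ = ℕ.+-cancelʳ-≤ 1 2 _ (≤-trans 3≤
        (subst (λ k → gain S (support y) ≤ gain (S ∪ ⁅ z ⁆) (support y) + k)
          (sym 1≡gain) (gain-after-≥ S z (support y))))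

  answer : ∀ S z → Legal S z → Answered S z
  answer S z legal with endangered? (S ∪ ⁅ z ⁆) z
  ... | no ¬e′ = answer-charged (relieved-move legal (flip contradiction ¬e′)) legal
  ... | yes e′@(leaf , ud′ , _) with endangered? S z
  ...   | yes e = answer-charged (relieved-move legal (λ _ → e)) legal
  -- Here `z` is a leaf endangered by its own move, and the weight need not drop at all. The move
  -- dominates only the support, which is not its own neighbour, so the support keeps its gain of at
  -- least 3 and the reply is worth 2 * 3 + 2 = 8.
  ...   | no ¬e = inj₂ (8 , drop-charging₂ z≤n , ≤-refl , endangered-reply e′ 3≤gain′)
    where
    3≤gain : 3 ≤ gain S (support z)
    3≤gain = ℕ.≰⇒> λ ≤2 → ¬e (leaf , ud′ ∘ dominated⁺ˡ , inj₂ ≤2)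
    3≤gain′ : 3 ≤ gain (S ∪ ⁅ z ⁆) (support z)
    3≤gain′ = ≤-trans 3≤gain (ℕ.≮⇒≥ λ less → let x , (z~x , _) , s~x = gain-lost {S} {z} {support z} less in
      ~-irrefl (leaf-unique leaf (~support z) z~x) s~x)

  -- The induction over positions.

  Bounded : Subset n → Set
  Bounded S = (∀ a → 4 * value dominator S a ≤ weight S) × (∀ a → 4 * value staller S a ≤ suc (weight S))

  dominator-step : Legal S v → weight (S ∪ ⁅ v ⁆) + 5 ≤ weight S →
    (∀ a → 4 * value staller (S ∪ ⁅ v ⁆) a ≤ suc (weight (S ∪ ⁅ v ⁆))) →
    ∀ a → 4 * value dominator S a ≤ weight S
  dominator-step {S} {v} legal drop bound = value-some-move legal λ a → begin
    4 * suc (value staller (S ∪ ⁅ v ⁆) a)   ≡⟨ ℕ.*-suc 4 _ ⟩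
    4 + 4 * value staller (S ∪ ⁅ v ⁆) a     ≤⟨ +-monoʳ-≤ 4 (bound a) ⟩
    4 + suc (weight (S ∪ ⁅ v ⁆))            ≡⟨ regroup (weight (S ∪ ⁅ v ⁆)) ⟩
    weight (S ∪ ⁅ v ⁆) + 5                  ≤⟨ drop ⟩
    weight S                                ∎
    where
    open ≤-Reasoning
    regroup : ∀ a → 4 + suc a ≡ a + 5
    regroup = solve-∀

  -- The slack 1 in the bound for Staller is what Dominator's drop of 5 leaves over the cost 4 of a
  -- move; a drop of 3 by Staller uses it up.
  bounded : ∀ S → Bounded S
  bounded = All.wfRec ⊃-wellFounded _ Bounded step
    where
    step : ∀ S → (∀ {S′} → S′ ⊃ S → Bounded S′) → Bounded S
    step S ih = dominator-bound , staller-bound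
      where
      play : Legal S v → weight (S ∪ ⁅ v ⁆) + 5 ≤ weight S → ∀ a → 4 * value dominator S a ≤ weight S
      play legal drop = dominator-step legal drop (proj₂ (ih (legal⇒⊃ legal)))

      dominator-bound : ∀ a → 4 * value dominator S a ≤ weight S
      dominator-bound with any? (λ w → leaf? w ×-dec undominated? S w ×-dec 2 ℕ.≤? gain S (support w))
      ... | yes (w , leaf , ud , 2≤gain) = play (support-legal w ud) (support-drop leaf ud 2≤gain ([] ∷ []) [])
      ... | no none with any? (λ v → 2 ℕ.≤? gain S v)
      ...   | no sparse = sparse-bound S (λ v → s≤s⁻¹ (ℕ.≰⇒> λ 2≤ → sparse (v , 2≤))) dominator
      -- A weakened leaf would be undominated with a support of gain at least 3, which the first
      -- search excluded. The drop is again 2 * 2 + 1, with `v` relieved.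
      ...   | yes (v , 2≤gain) = play legal
              (drop-without-weakening 2≤gain
                (λ (leaf , ud , _ , 3≤ , _) → none (_ , leaf , ud ∘ dominated⁺ˡ , ≤-trans (ℕ.n≤1+n 2) 3≤))
                ([] ∷ []) (relieved-move legal before ∷ []))
        where
        legal : Legal S v
        legal = gain⇒legal (≤-trans (ℕ.n≤1+n 1) 2≤gain)
        before : Endangered (S ∪ ⁅ v ⁆) v → Endangered S v
        before e′@(leaf , ud′ , _) = endangered-before
          (ℕ.≰⇒≥ λ 2≤ → none (v , leaf , ud′ ∘ dominated⁺ˡ , 2≤)) e′

      staller-bound : ∀ a → 4 * value staller S a ≤ suc (weight S)
      staller-bound = value-all-moves staller λ {z} → after z
        where
        open ≤-Reasoning
        after : ∀ z → Legal S z → ∀ a → 4 * suc (value dominator (S ∪ ⁅ z ⁆) a) ≤ suc (weight S)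
        after z legal a with answer S z legal
        ... | inj₁ drop = begin
          4 * suc (value dominator (S ∪ ⁅ z ⁆) a)   ≡⟨ ℕ.*-suc 4 _ ⟩
          4 + 4 * value dominator (S ∪ ⁅ z ⁆) a     ≤⟨ +-monoʳ-≤ 4 (proj₁ (ih (legal⇒⊃ legal)) a) ⟩
          4 + weight (S ∪ ⁅ z ⁆)                    ≡⟨ regroup (weight (S ∪ ⁅ z ⁆)) ⟩
          suc (weight (S ∪ ⁅ z ⁆) + 3)              ≤⟨ s≤s drop ⟩
          suc (weight S)                            ∎
          where
          regroup : ∀ a → 4 + a ≡ suc (a + 3)
          regroup = solve-∀
        ... | inj₂ (d , drop , d≤8 , v , legal′ , drop′) = value-after a
          where
          S′ = S ∪ ⁅ z ⁆
          S″ = S′ ∪ ⁅ v ⁆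
          double : weight S″ + 8 ≤ weight S
          double = begin
            weight S″ + 8                 ≡⟨ cong (weight S″ +_) (sym (ℕ.m+[n∸m]≡n d≤8)) ⟩
            weight S″ + (d + (8 ℕ.∸ d))   ≡⟨ sym (ℕ.+-assoc (weight S″) d _) ⟩
            weight S″ + d + (8 ℕ.∸ d)     ≤⟨ +-monoˡ-≤ _ drop′ ⟩
            weight S′ + (8 ℕ.∸ d)         ≤⟨ drop ⟩
            weight S                      ∎
          regroup : ∀ a → 4 + (4 + suc a) ≡ suc (a + 8)
          regroup = solve-∀
          value-after : ∀ a → 4 * suc (value dominator S′ a) ≤ suc (weight S)
          value-after a = begin
            4 * suc (value dominator S′ a)   ≡⟨ ℕ.*-suc 4 _ ⟩
            4 + 4 * value dominator S′ a     ≤⟨ +-monoʳ-≤ 4 (value-some-move legal′ reply a) ⟩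
            4 + (4 + suc (weight S″))        ≡⟨ regroup (weight S″) ⟩
            suc (weight S″ + 8)              ≤⟨ s≤s double ⟩
            suc (weight S)                   ∎
            where
            reply : ∀ a → 4 * suc (value staller S″ a) ≤ 4 + suc (weight S″)
            reply a = ≤-trans (≤-reflexive (ℕ.*-suc 4 _))
              (+-monoʳ-≤ 4 (proj₂ (ih (⊂-trans (legal⇒⊃ legal) (legal⇒⊃ legal′))) a))

  -- Initially gains are at least degrees and, by condition (a), supports of leaves have degree at
  -- least 3, so no leaf is endangered.
  weight-⊥ : weight ⊥ ≤ 3 * n
  weight-⊥ = begin
    weight ⊥
      ≤⟨ +-mono-≤ (*-monoʳ-≤ 2 (count≤n (undominated? ⊥))) (+-mono-≤ (count≤n (legal? ⊥)) (≤-reflexive none)) ⟩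
    2 * n + (n + 0)   ≡⟨ regroup n ⟩
    3 * n             ∎
    where
    open ≤-Reasoning
    regroup : ∀ a → 2 * a + (a + 0) ≡ 3 * a
    regroup = solve-∀
    all-undominated : ∀ y → Undominated ⊥ y
    all-undominated y (x , x∈⊥ , _) = ∉⊥ x∈⊥
    degree≤gain : ∀ v → degree v ≤ gain ⊥ v
    degree≤gain v = subst (_≤ gain ⊥ v) (sym (degree≡count v))
      (count-mono (v ~?_) (new? ⊥ v) λ {y} v~y → v~y , all-undominated y)
    none : count (endangered? ⊥) ≡ 0
    none = count-empty (endangered? ⊥) λ where
      (_ , _ , inj₁ dom) → all-undominated _ dom
      {w} (leaf , _ , inj₂ ≤2) → ℕ.1+n≰n (≤-trans (≤-trans (3≤degree-support leaf) (degree≤gain (support w))) ≤2)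

theorem2 : ∀ (n : ℕ) (G : Graph n) → let open Graph G in
    (noIsolated : NoIsolatedVertices) →
    (∀ (u v : Fin n) → u ~ v → 4 ≤ degree u + degree v) →
    (∀ (u v : Fin n) → Leaf u → Leaf v → ¬ Distance u v 4) →
    4 * γtg G noIsolated ≤ 3 * n
theorem2 n G noIsolated degreeSum leafDistance =
  ≤-trans (proj₁ (bounded ⊥) (⊃-wellFounded ⊥)) weight-⊥
  where open Game G noIsolated degreeSum leafDistance
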